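{- Let $\lambda$ be the Lebesgue valuation on $\mathbb R$, namely the restriction of Lebesgue measure to the open subsets of $\mathbb R$ (with its standard topology). Then $\lambda$ is not point-continuous, hence not minimal.
   Context: $\overline{\mathbb R}_+=[0,+\infty]$. For a topological space $X$ with lattice of open sets $\mathcal O X$, a valuation on $X$ is a map $\nu\colon\mathcal O X\to\overline{\mathbb R}_+$ that is strict ($\nu(\emptyset)=0$), modular ($\nu(U\cup V)+\nu(U\cap V)=\nu(U)+\nu(V)$) and monotonic; it is a continuous valuation if it is moreover Scott-continuous (preserves directed suprema). $\mathbf V X$ is the dcpo of continuous valuations on $X$, ordered pointwise. A valuation $\nu$ on $X$ is point-continuous if and only if for every open subset $U$ of $X$, for every $r\in\mathbb R_+$ such that $r<\nu(U)$, there is a finite subset $A$ of $U$ such that, for every open neighborhood $V$ of $A$, $\nu(V)>r$. A simple valuation is a finite linear combination $\sum_{i=1}^n r_i\delta_{x_i}$ of Dirac valuations with $r_i\in\mathbb R_+$. The minimal valuations on $X$ are the elements of the smallest subset of $\mathbf V X$ containing all simple valuations and closed under directed suprema taken in $\mathbf V X$. -}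

module Defs where

open import Level using (Level; Lift; lift; lower; 0ℓ) renaming (suc to lsuc)
open import Data.Bool.Base using (Bool; true; false; if_then_else_)
open import Data.Empty.Polymorphic using (⊥)
open import Data.List.Base using (List; foldr)
open import Data.List.Relation.Unary.All using (All)
open import Data.Nat.Base using (ℕ; zero; suc)
open import Data.Product using (Σ; Σ-syntax; ∃; ∃-syntax; _×_; _,_; proj₁; proj₂)
open import Data.Rational.Base using (ℚ; 0ℚ; 1ℚ; _<_; _≤_; _+_; _-_; _*_; -_)
open import Data.Rational.Properties
open import Data.Sum.Base using (_⊎_; inj₁; inj₂)
open import Relation.Binary.Core using (Rel)
open import Relation.Binary.PropositionalEquality using (_≡_; trans; cong; subst)
open import Relation.Nullary using (¬_; yes; no)
open import Relation.Unary using (Pred; _∈_; _∉_; _⊆_; _≐_; _∩_; ⋃) renaming (_∪_ to _∪ᵖ_; ∅ to ∅ᵖ; U to Full)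

private
  variable
    a i r : Level

1ℓ 2ℓ 3ℓ : Level
1ℓ = lsuc 0ℓ
2ℓ = lsuc 1ℓ
3ℓ = lsuc 2ℓ

-- A directed subset of A is represented by a family f with that image.

Directed : {A : Set a} {I : Set i} → Rel A r → (I → A) → Set _
Directed {I = I} _≲_ f = I × (∀ j k → ∃[ l ] (f j ≲ f l) × (f k ≲ f l))

IsSup : {A : Set a} {I : Set i} → Rel A r → (I → A) → A → Set _
IsSup _≲_ f s = (∀ j → f j ≲ s) × (∀ t → (∀ j → f j ≲ t) → s ≲ t)

-- A down-closed set of rationals without greatest element; `below q`
-- reads "q is strictly less than the (possibly infinite) number".
-- In the presence of excluded middle, these are exactly the elements
-- of [-∞,+∞], and the proper nonempty ones are Dedekind's reals.

record Cut (ℓ : Level) : Set (lsuc ℓ) where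
  field
    below   : Pred ℚ ℓ
    down    : ∀ {p q} → p < q → q ∈ below → p ∈ below
    rounded : ∀ {p} → p ∈ below → ∃[ q ] (p < q) × (q ∈ below)

record ℝ : Set₁ where
  field
    cut       : Cut 0ℓ
  open Cut cut public
  field
    inhabited : ∃[ q ] q ∈ below
    bounded   : ∃[ q ] q ∉ below

_<ℝ_ : ℚ → ℝ → Set
q <ℝ x = q ∈ ℝ.below x

_ℝ<_ : ℝ → ℚ → Set
x ℝ< q = ∃[ p ] (p < q) × (p ∉ ℝ.below x)

-- The extended half-line.  These cuts are one universe above those of ℝ,
-- since the Lebesgue measure of a set quantifies over the points of ℝ.

record [0,∞] : Set₂ where
  field
    cut     : Cut 1ℓ
  open Cut cut public
  field
    nonneg  : ∀ {q} → q < 0ℚ → q ∈ below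

infix 4 _≤∞_ _≈∞_ _<∞_

_≤∞_ _≈∞_ _<∞_ : Rel [0,∞] 1ℓ
x ≤∞ y = [0,∞].below x ⊆ [0,∞].below y
x ≈∞ y = (x ≤∞ y) × (y ≤∞ x)
x <∞ y = ∃[ q ] (q ∉ [0,∞].below x) × (q ∈ [0,∞].below y)

-- The elements other than +∞, the cut containing every rational.

ℝ₊ : Set₂
ℝ₊ = Σ[ x ∈ [0,∞] ] ∃[ q ] q ∉ [0,∞].below x

0∞ : [0,∞]
0∞ = record
  { cut = record
    { below   = λ q → Lift 1ℓ (q < 0ℚ)
    ; down    = λ p<q q<0 → lift (<-trans p<q (lower q<0))
    ; rounded = λ p<0 → let m , p<m , m<0 = <-dense (lower p<0) in m , p<m , lift m<0
    }
  ; nonneg = lift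
  }

infixl 6 _+∞_
infixl 7 _*∞_

private
  p-q+q : ∀ p q → (p - q) + q ≡ p
  p-q+q p q = trans (+-assoc p (- q) q) (trans (cong (p +_) (+-inverseˡ q)) (+-identityʳ p))

  -- for q < 0, some s < 0 and t < 0 satisfy q < s + t
  split : ∀ {q} → q < 0ℚ → ∃[ s ] ∃[ t ] (s < 0ℚ) × (t < 0ℚ) × (q < s + t)
  split {q} q<0 =
    let t , q<t , t<0 = <-dense q<0
        q-t<0         = subst (q - t <_) (+-inverseʳ t) (+-monoˡ-< (- t) q<t)
        s , q-t<s , s<0 = <-dense q-t<0
    in s , t , s<0 , t<0 , subst (_< s + t) (p-q+q q t) (+-monoˡ-< t q-t<s)

_+∞_ : [0,∞] → [0,∞] → [0,∞]
x +∞ y = record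
  { cut = record
    { below   = λ q → ∃[ s ] ∃[ t ] (s ∈ x.below) × (t ∈ y.below) × (q < s + t)
    ; down    = λ p<q (s , t , s∈x , t∈y , q<) → s , t , s∈x , t∈y , <-trans p<q q<
    ; rounded = λ (s , t , s∈x , t∈y , p<) → let m , p<m , m< = <-dense p< in m , p<m , (s , t , s∈x , t∈y , m<)
    }
  ; nonneg = λ q<0 → let s , t , s<0 , t<0 , q< = split q<0 in s , t , x.nonneg s<0 , y.nonneg t<0 , q<
  }
  where
  module x = [0,∞] x
  module y = [0,∞] y

-- With the usual convention 0 · (+∞) = 0.

_*∞_ : [0,∞] → [0,∞] → [0,∞]
x *∞ y = record
  { cut = record
    { below   = λ q → (q < 0ℚ) ⊎ PositivePart q
    ; down    = λ where
        p<q (inj₁ q<0) → inj₁ (<-trans p<q q<0)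
        p<q (inj₂ (s , t , s∈x , t∈y , 0<s , 0<t , q<)) → inj₂ (s , t , s∈x , t∈y , 0<s , 0<t , <-trans p<q q<)
    ; rounded = λ where
        (inj₁ p<0) → let m , p<m , m<0 = <-dense p<0 in m , p<m , inj₁ m<0
        (inj₂ (s , t , s∈x , t∈y , 0<s , 0<t , p<)) →
          let m , p<m , m< = <-dense p< in m , p<m , inj₂ (s , t , s∈x , t∈y , 0<s , 0<t , m<)
    }
  ; nonneg = inj₁
  }
  where
  module x = [0,∞] x
  module y = [0,∞] y

  PositivePart : Pred ℚ 1ℓ
  PositivePart q = ∃[ s ] ∃[ t ] (s ∈ x.below) × (t ∈ y.below) × (0ℚ < s) × (0ℚ < t) × (q < s * t)

-- q is strictly below the infimum iff some q′ > q is a lower bound of f.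
-- It suffices that q′ be strictly below every f j: lower q′ a little.

⨅ : {J : Set₁} → (J → [0,∞]) → [0,∞]
⨅ {J} f = record
  { cut = record
    { below   = λ q → ∃[ q′ ] (q < q′) × (∀ j → q′ ∈ [0,∞].below (f j))
    ; down    = λ p<q (q′ , q<q′ , q′∈) → q′ , <-trans p<q q<q′ , q′∈
    ; rounded = λ (q′ , p<q′ , q′∈) → let m , p<m , m<q′ = <-dense p<q′ in m , p<m , (q′ , m<q′ , q′∈)
    }
  ; nonneg = λ q<0 → let m , q<m , m<0 = <-dense q<0 in m , q<m , λ j → [0,∞].nonneg (f j) m<0
  }

-- Predicates over Set₁ index families large enough to cover every subset
-- of the topology.  Such a union lives one universe too high to be a
-- `Pred Carrier 0ℓ`, whence its replacement by an equivalent W.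

record TopologicalSpace : Set₂ where
  field
    Carrier : Set₁
    IsOpen  : Pred (Pred Carrier 0ℓ) 1ℓ
    Full-open : IsOpen Full
    ∩-open  : ∀ {V W} → IsOpen V → IsOpen W → IsOpen (V ∩ W)
    ⋃-open  : {I : Set₁} (f : I → Pred Carrier 0ℓ) {W : Pred Carrier 0ℓ} →
              (∀ j → IsOpen (f j)) → W ≐ ⋃ I f → IsOpen W

record Open (X : TopologicalSpace) : Set₁ where
  open TopologicalSpace X
  field
    set    : Pred Carrier 0ℓ
    isOpen : IsOpen set

module _ {X : TopologicalSpace} where
  open TopologicalSpace X
  open Open

  infix 4 _⊑_

  _⊑_ : Rel (Open X) 1ℓ
  V ⊑ W = set V ⊆ set W

  ∅ : Open X
  ∅ = record
    { set    = ∅ᵖ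
    ; isOpen = ⋃-open {I = ⊥} (λ ()) (λ ()) ((λ ()) , λ ())
    }

  infixr 7 _⊓_
  infixr 6 _⊔ᵒ_

  _⊓_ : Open X → Open X → Open X
  V ⊓ W = record { set = set V ∩ set W ; isOpen = ∩-open (isOpen V) (isOpen W) }

  _⊔ᵒ_ : Open X → Open X → Open X
  V ⊔ᵒ W = record
    { set    = set V ∪ᵖ set W
    ; isOpen = ⋃-open {I = Lift 1ℓ Bool} (λ b → set (pick b)) (λ b → isOpen (pick b))
        ( (λ { (inj₁ v) → lift true , v ; (inj₂ w) → lift false , w })
        , (λ { (lift true , v) → inj₁ v ; (lift false , w) → inj₂ w }) )
    }
    where
    pick : Lift 1ℓ Bool → Open X
    pick (lift b) = if b then V else W

module _ (X : TopologicalSpace) where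
  open TopologicalSpace X

  SetFunction : Set₂
  SetFunction = Open X → [0,∞]

  record IsValuation (ν : SetFunction) : Set₁ where
    field
      strict    : ν ∅ ≈∞ 0∞
      modular   : ∀ V W → ν (V ⊔ᵒ W) +∞ ν (V ⊓ W) ≈∞ ν V +∞ ν W
      monotonic : ∀ {V W} → V ⊑ W → ν V ≤∞ ν W

  ScottContinuous : SetFunction → Set₂
  ScottContinuous ν = {I : Set₁} (f : I → Open X) → Directed _⊑_ f →
                      ∀ W → IsSup _⊑_ f W → IsSup _≤∞_ (λ j → ν (f j)) (ν W)

  record ContinuousValuation : Set₂ where
    field
      apply           : SetFunction
      isValuation     : IsValuation apply
      scottContinuous : ScottContinuous apply

module _ {X : TopologicalSpace} where
  open TopologicalSpace X
  open Open
  open ContinuousValuation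

  infix 4 _≼_ _≋_

  _≋_ : Rel (SetFunction X) 1ℓ
  μ ≋ ν = ∀ V → μ V ≈∞ ν V

  _≼_ : Rel (ContinuousValuation X) 1ℓ
  μ ≼ ν = ∀ V → apply μ V ≤∞ apply ν V

  -- The finite subset A is given by a list of its elements.  The definition
  -- makes sense for any ν, valuation or not.

  PointContinuous : SetFunction X → Set₂
  PointContinuous ν =
    ∀ (V : Open X) (r : ℝ₊) → proj₁ r <∞ ν V →
    ∃[ A ] All (_∈ set V) A × (∀ (W : Open X) → All (_∈ set W) A → proj₁ r <∞ ν W)

  -- 1 on the open neighbourhoods of x, and 0 elsewhere

  δ : Carrier → SetFunction X
  δ x V = record
    { cut = record
      { below   = λ q → Lift 1ℓ ((q < 0ℚ) ⊎ ((x ∈ set V) × (q < 1ℚ)))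
      ; down    = λ where
          p<q (lift (inj₁ q<0)) → lift (inj₁ (<-trans p<q q<0))
          p<q (lift (inj₂ (x∈V , q<1))) → lift (inj₂ (x∈V , <-trans p<q q<1))
      ; rounded = λ where
          (lift (inj₁ p<0)) → let m , p<m , m<0 = <-dense p<0 in m , p<m , lift (inj₁ m<0)
          (lift (inj₂ (x∈V , p<1))) → let m , p<m , m<1 = <-dense p<1 in m , p<m , lift (inj₂ (x∈V , m<1))
      }
    ; nonneg = λ q<0 → lift (inj₁ q<0)
    }

  simple : List (ℝ₊ × Carrier) → SetFunction X
  simple ts V = foldr (λ ((r , _) , x) s → r *∞ δ x V +∞ s) 0∞ ts

  -- `directedSup` allows index types in the universe of
  -- `ContinuousValuation X` itself, hence all directed subsets.

  data Minimal : ContinuousValuation X → Set₃ where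
    isSimple    : ∀ {ν} ts → apply ν ≋ simple ts → Minimal ν
    directedSup : ∀ {ν} {I : Set₂} (f : I → ContinuousValuation X) →
                  Directed _≼_ f → (∀ j → Minimal (f j)) → IsSup _≼_ f ν → Minimal ν

  -- φ is the underlying function of some minimal valuation.

  IsMinimal : SetFunction X → Set₃
  IsMinimal φ = ∃[ ν ] Minimal ν × (apply ν ≋ φ)

_∈⟨_,_⟩ : ℝ → ℚ → ℚ → Set
x ∈⟨ a , b ⟩ = (a <ℝ x) × (x ℝ< b)

-- The topology generated by the open intervals with rational endpoints.

ℝ-IsOpen : Pred (Pred ℝ 0ℓ) 1ℓ
ℝ-IsOpen V = ∀ x → x ∈ V → ∃[ a ] ∃[ b ] x ∈⟨ a , b ⟩ × (∀ y → y ∈⟨ a , b ⟩ → y ∈ V)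

private
  meet : ∀ x {a b c d} → x ∈⟨ a , b ⟩ → x ∈⟨ c , d ⟩ →
         ∃[ e ] ∃[ f ] x ∈⟨ e , f ⟩ ×
           (∀ y → y ∈⟨ e , f ⟩ → y ∈⟨ a , b ⟩ × y ∈⟨ c , d ⟩)
  meet x {a} {b} {c} {d} (a<x , x<b) (c<x , x<d) =
    let e , e<x , lo = left ; f , x<f , hi = right
    in e , f , (e<x , x<f) , λ y (e<y , y<f) →
         (proj₁ (lo y e<y) , proj₁ (hi y y<f)) , (proj₂ (lo y e<y) , proj₂ (hi y y<f))
    where
    loosenˡ : ∀ {p q} y → p ≤ q → q <ℝ y → p <ℝ y
    loosenˡ {p} {q} y p≤q q<y with p <? q
    ... | yes p<q = ℝ.down y p<q q<y
    ... | no  p≮q = subst (_<ℝ y) (≤-antisym (≮⇒≥ p≮q) p≤q) q<y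

    loosenʳ : ∀ {p q} y → p ≤ q → y ℝ< p → y ℝ< q
    loosenʳ y p≤q (s , s<p , s∉y) = s , <-≤-trans s<p p≤q , s∉y

    left : ∃[ e ] (e <ℝ x) × (∀ y → e <ℝ y → (a <ℝ y) × (c <ℝ y))
    left with a ≤? c
    ... | yes a≤c = c , c<x , λ y c<y → loosenˡ y a≤c c<y , c<y
    ... | no  a≰c = a , a<x , λ y a<y → a<y , ℝ.down y (≰⇒> a≰c) a<y

    right : ∃[ f ] (x ℝ< f) × (∀ y → y ℝ< f → (y ℝ< b) × (y ℝ< d))
    right with b ≤? d
    ... | yes b≤d = b , x<b , λ y y<b → y<b , loosenʳ y b≤d y<b
    ... | no  b≰d = d , x<d , λ y y<d → loosenʳ y (<⇒≤ (≰⇒> b≰d)) y<d , y<d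

ℝ-space : TopologicalSpace
ℝ-space = record
  { Carrier   = ℝ
  ; IsOpen    = ℝ-IsOpen
  ; Full-open = λ x _ →
      let a , a<x = ℝ.inhabited x
          b , b≮x = ℝ.bounded x
      in a , b + 1ℚ , (a<x , b , b<b+1 b , b≮x) , λ _ _ → _
  ; ∩-open    = λ oV oW x (x∈V , x∈W) →
      let a , b , x∈ab , ab⊆V = oV x x∈V
          c , d , x∈cd , cd⊆W = oW x x∈W
          e , f , x∈ef , ef⊆  = meet x x∈ab x∈cd
      in e , f , x∈ef , λ y y∈ef → ab⊆V y (proj₁ (ef⊆ y y∈ef)) , cd⊆W y (proj₂ (ef⊆ y y∈ef))
  ; ⋃-open    = λ f of (W⊆ , ⊆W) x x∈W →
      let j , x∈fj = W⊆ x∈W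
          a , b , x∈ab , ab⊆fj = of j x x∈fj
      in a , b , x∈ab , λ y y∈ab → ⊆W (j , ab⊆fj y y∈ab)
  }
  where
  b<b+1 : ∀ b → b < b + 1ℚ
  b<b+1 b = subst (_< b + 1ℚ) (+-identityʳ b) (+-monoʳ-< b (positive⁻¹ 1ℚ))

record Interval : Set where
  field
    lo hi : ℚ
    lo≤hi : lo ≤ hi

open Interval

⟦_⟧ : Interval → Pred ℝ 0ℓ
⟦ J ⟧ x = x ∈⟨ lo J , hi J ⟩

partialLength : (ℕ → Interval) → ℕ → ℚ
partialLength J zero    = 0ℚ
partialLength J (suc n) = partialLength J n + (hi (J n) - lo (J n))

-- The sum of the series is the supremum of its partial sums: q is strictly
-- below it iff q is strictly below some partial sum.

totalLength : (ℕ → Interval) → [0,∞]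
totalLength J = record
  { cut = record
    { below   = λ q → Lift 1ℓ (∃[ n ] q < partialLength J n)
    ; down    = λ p<q (lift (n , q<)) → lift (n , <-trans p<q q<)
    ; rounded = λ (lift (n , p<)) → let m , p<m , m< = <-dense p< in m , p<m , lift (n , m<)
    }
  ; nonneg = λ q<0 → lift (0 , q<0)
  }

Cover : Pred ℝ 0ℓ → Set₁
Cover A = Σ[ J ∈ (ℕ → Interval) ] A ⊆ ⋃ ℕ (λ n → ⟦ J n ⟧)

-- This is the outer measure, defined on all subsets; it agrees with Lebesgue
-- measure on the measurable ones, in particular on the open ones.

lebesgueMeasure : Pred ℝ 0ℓ → [0,∞]
lebesgueMeasure A = ⨅ {Cover A} (λ (J , _) → totalLength J)

lebesgueValuation : SetFunction ℝ-space
lebesgueValuation V = lebesgueMeasure (Open.set V)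

{-# OPTIONS --safe #-}
module Submission where

-- If intervals J n cover ℝ, the length of the part of J 0, …, J (n-1) below t
-- grows with slope 1 while t runs through one of them, so it can keep up with
-- t past any point; this makes the total length infinite.  A finite set has
-- neighbourhoods of length at most 1, so λ is not point-continuous.  Simple
-- valuations are point-continuous, and so are directed suprema of such
-- valuations because these suprema are computed pointwise.

open import Defs
open import Algebra.Bundles using (CommutativeRing)
open import Axiom.ExcludedMiddle using (ExcludedMiddle)
open import Data.Integer.Base as ℤ using (+_; -[1+_])
import Data.Integer.Properties as ℤ
open import Data.List.Base using ([]; _∷_)
open import Data.List.Relation.Unary.All as All using (All; []; _∷_)
open import Data.Nat.Base as ℕ using (ℕ; zero; suc)
import Data.Nat.Properties as ℕ
open import Data.Product using (∃-syntax; Σ-syntax; _×_; _,_; proj₁; proj₂)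
open import Data.Rational.Base renaming (_⊓_ to _⊓ℚ_; _⊔_ to _⊔ℚ_)
open import Data.Rational.Properties
open import Data.Rational.Solver using (module +-*-Solver)
open import Data.Rational.Unnormalised.Base as ℚᵘ using (mkℚᵘ; *≡*)
import Data.Rational.Unnormalised.Properties as ℚᵘ
open import Data.Sum.Base using (inj₁; inj₂)
open import Data.Unit.Base using (tt)
open import Function.Base using (id)
open import Level using (Lift; lift; 0ℓ)
open import Relation.Binary.PropositionalEquality using (_≡_; refl; sym; trans; cong; subst)
open import Relation.Nullary using (¬_; yes; no; contradiction)
open import Relation.Nullary.Decidable using (True; toWitness; fromWitness; decidable-stable)
open import Relation.Unary using (Pred; _∈_)

open import Algebra.Properties.Semiring.Mult (CommutativeRing.semiring +-*-commutativeRing)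
  using (×-assoc-*) renaming (_×_ to _·_)

open Interval
open Open using (set)
open ContinuousValuation
open IsValuation

-- Rational arithmetic and the Archimedean property.

cancel : ∀ p q → p + (q - p) ≡ q
cancel = solve 2 (λ p q → p :+ (q :- p) := q) refl
  where open +-*-Solver

p<q⇒0<q-p : ∀ {p q} → p < q → 0ℚ < q - p
p<q⇒0<q-p {p} {q} p<q = subst (_< q - p) (+-inverseʳ p) (+-monoˡ-< (- p) p<q)

p<p+q : ∀ p {q} → 0ℚ < q → p < p + q
p<p+q p {q} 0<q = subst (_< p + q) (+-identityʳ p) (+-monoʳ-< p 0<q)

-- Since `_/_` normalises by a gcd, it does not compute at a variable `n`; the identity is checked
-- on unnormalised fractions instead.
suc/1 : ∀ n → + suc n / 1 ≡ 1ℚ + + n / 1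
suc/1 n = toℚᵘ-injective (begin
  toℚᵘ (+ suc n / 1)          ≈⟨ toℚᵘ-fromℚᵘ (mkℚᵘ (+ suc n) 0) ⟩
  mkℚᵘ (+ suc n) 0            ≈⟨ *≡* (cong (ℤ._* + 1) (cong (ℤ._+_ (+ 1)) (sym (ℤ.*-identityʳ (+ n))))) ⟩
  mkℚᵘ (+ 1) 0 ℚᵘ.+ mkℚᵘ (+ n) 0 ≈⟨ ℚᵘ.+-congʳ (mkℚᵘ (+ 1) 0) (toℚᵘ-fromℚᵘ (mkℚᵘ (+ n) 0)) ⟨
  toℚᵘ 1ℚ ℚᵘ.+ toℚᵘ (+ n / 1) ≈⟨ toℚᵘ-homo-+ 1ℚ (+ n / 1) ⟨
  toℚᵘ (1ℚ + + n / 1)         ∎)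
  where open ℚᵘ.≃-Reasoning

n/1≡n·1 : ∀ n → + n / 1 ≡ n · 1ℚ
n/1≡n·1 zero    = refl
n/1≡n·1 (suc n) = trans (suc/1 n) (cong (_+_ 1ℚ) (n/1≡n·1 n))

i≤∣i∣*suc : ∀ i d → i ℤ.≤ + ℤ.∣ i ∣ ℤ.* + suc d
i≤∣i∣*suc (+ n)    d = subst (+ n ℤ.≤_) (ℤ.pos-* n (suc d)) (ℤ.+≤+ (ℕ.m≤m*n n (suc d)))
i≤∣i∣*suc -[1+ n ] d = ℤ.-≤+

p≤∣↥p∣/1 : ∀ p → p ≤ + ℤ.∣ ↥ p ∣ / 1
p≤∣↥p∣/1 p@(mkℚ i d _) = toℚᵘ-cancel-≤ (ℚᵘ.≤-respʳ-≃ (ℚᵘ.≃-sym (toℚᵘ-fromℚᵘ (mkℚᵘ (+ ℤ.∣ i ∣) 0)))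
  (ℚᵘ.*≤* (subst (ℤ._≤ + ℤ.∣ i ∣ ℤ.* + suc d) (sym (ℤ.*-identityʳ i)) (i≤∣i∣*suc i d))))

-- The absolute numerator of `p / ε` serves as `n`, since a denominator is at least 1.
archimedean : ∀ p {ε} → 0ℚ < ε → ∃[ n ] p ≤ n · ε
archimedean p {ε} 0<ε = n , (begin
  p                 ≡⟨ p/ε*ε ⟨
  p/ε * ε           ≤⟨ *-monoʳ-≤-nonNeg ε {{pos⇒nonNeg ε}} (p≤∣↥p∣/1 p/ε) ⟩
  (+ n / 1) * ε     ≡⟨ cong (_* ε) (n/1≡n·1 n) ⟩
  n · 1ℚ * ε        ≡⟨ ×-assoc-* n 1ℚ ε ⟩
  n · (1ℚ * ε)      ≡⟨ cong (n ·_) (*-identityˡ ε) ⟩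
  n · ε             ∎)
  where
  open ≤-Reasoning
  instance
    ε-positive : Positive ε
    ε-positive = positive 0<ε
    ε-nonZero : NonZero ε
    ε-nonZero = pos⇒nonZero ε
  p/ε = p * 1/ ε
  n = ℤ.∣ ↥ p/ε ∣
  p/ε*ε : p/ε * ε ≡ p
  p/ε*ε = trans (*-assoc p (1/ ε) ε) (trans (cong (p *_) (*-inverseˡ ε)) (*-identityʳ p))

-- Countable interval covers of the line have infinite total length.

-- The length of J ∩ (-∞,t].

lengthUpTo : Interval → ℚ → ℚ
lengthUpTo J t = hi J ⊓ℚ (lo J ⊔ℚ t) - lo J

lengthUpTo-mono : ∀ J {s t} → s ≤ t → lengthUpTo J s ≤ lengthUpTo J t
lengthUpTo-mono J s≤t = +-monoˡ-≤ (- lo J) (⊓-monoʳ-≤ (hi J) (⊔-monoʳ-≤ (lo J) s≤t))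

lengthUpTo-nonneg : ∀ J t → 0ℚ ≤ lengthUpTo J t
lengthUpTo-nonneg J t = subst (_≤ lengthUpTo J t) (+-inverseʳ (lo J))
  (+-monoˡ-≤ (- lo J) (⊓-glb (lo≤hi J) (p≤p⊔q (lo J) t)))

lengthUpTo≤length : ∀ J t → lengthUpTo J t ≤ hi J - lo J
lengthUpTo≤length J t = +-monoˡ-≤ (- lo J) (p⊓q≤p (hi J) (lo J ⊔ℚ t))

lengthUpTo-inside : ∀ J {t} → lo J ≤ t → t ≤ hi J → lengthUpTo J t ≡ t - lo J
lengthUpTo-inside J {t} lo≤t t≤hi = cong (_- lo J)
  (trans (cong (hi J ⊓ℚ_) (p≤q⇒p⊔q≡q lo≤t)) (p≥q⇒p⊓q≡q t≤hi))

lengthUpTo-grow : ∀ J {t} → lo J ≤ t → t ≤ hi J → lengthUpTo J t + (hi J - t) ≡ lengthUpTo J (hi J)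
lengthUpTo-grow J {t} lo≤t t≤hi
  rewrite lengthUpTo-inside J lo≤t t≤hi | lengthUpTo-inside J (lo≤hi J) ≤-refl
  = solve 3 (λ l t h → (t :- l) :+ (h :- t) := h :- l) refl (lo J) t (hi J)
  where open +-*-Solver

partialLengthUpTo : (ℕ → Interval) → ℚ → ℕ → ℚ
partialLengthUpTo J t zero    = 0ℚ
partialLengthUpTo J t (suc n) = partialLengthUpTo J t n + lengthUpTo (J n) t

module _ (J : ℕ → Interval) where

  partialLengthUpTo-mono : ∀ n {s t} → s ≤ t → partialLengthUpTo J s n ≤ partialLengthUpTo J t n
  partialLengthUpTo-mono zero    s≤t = ≤-refl
  partialLengthUpTo-mono (suc n) s≤t = +-mono-≤ (partialLengthUpTo-mono n s≤t) (lengthUpTo-mono (J n) s≤t)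

  partialLengthUpTo≤partialLength : ∀ n t → partialLengthUpTo J t n ≤ partialLength J n
  partialLengthUpTo≤partialLength zero    t = ≤-refl
  partialLengthUpTo≤partialLength (suc n) t =
    +-mono-≤ (partialLengthUpTo≤partialLength n t) (lengthUpTo≤length (J n) t)

  partialLengthUpTo-≤suc : ∀ t n → partialLengthUpTo J t n ≤ partialLengthUpTo J t (suc n)
  partialLengthUpTo-≤suc t n = subst (_≤ partialLengthUpTo J t (suc n)) (+-identityʳ _)
    (+-monoʳ-≤ (partialLengthUpTo J t n) (lengthUpTo-nonneg (J n) t))

  partialLengthUpTo-≤+ : ∀ t n k → partialLengthUpTo J t n ≤ partialLengthUpTo J t (k ℕ.+ n)
  partialLengthUpTo-≤+ t n zero    = ≤-refl
  partialLengthUpTo-≤+ t n (suc k) =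
    ≤-trans (partialLengthUpTo-≤+ t n k) (partialLengthUpTo-≤suc t (k ℕ.+ n))

  -- The summand of `J k` gains exactly `hi (J k) - t`, and every other summand is monotone in the
  -- threshold. The induction on `n` peels off summands until it reaches that of `J k`.
  partialLengthUpTo-grow : ∀ {k n} → k ℕ.< n → ∀ {t} → lo (J k) ≤ t → t ≤ hi (J k) →
    partialLengthUpTo J t n + (hi (J k) - t) ≤ partialLengthUpTo J (hi (J k)) n
  partialLengthUpTo-grow {k} {suc n} k<1+n {t} lo≤t t≤hi with ℕ.m<1+n⇒m<n∨m≡n k<1+n
  ... | inj₁ k<n = begin
    a + b + c ≡⟨ solve 3 (λ a b c → a :+ b :+ c := (a :+ c) :+ b) refl a b c ⟩
    a + c + b ≤⟨ +-mono-≤ (partialLengthUpTo-grow k<n lo≤t t≤hi) (lengthUpTo-mono (J n) t≤hi) ⟩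
    partialLengthUpTo J (hi (J k)) (suc n) ∎
    where
    open ≤-Reasoning
    open +-*-Solver
    a = partialLengthUpTo J t n
    b = lengthUpTo (J n) t
    c = hi (J k) - t
  ... | inj₂ refl = begin
    a + b + c   ≡⟨ +-assoc a b c ⟩
    a + (b + c) ≡⟨ cong (_+_ a) (lengthUpTo-grow (J k) lo≤t t≤hi) ⟩
    a + lengthUpTo (J k) (hi (J k)) ≤⟨ +-monoˡ-≤ _ (partialLengthUpTo-mono k t≤hi) ⟩
    partialLengthUpTo J (hi (J k)) (suc k) ∎
    where
    open ≤-Reasoning
    a = partialLengthUpTo J t k
    b = lengthUpTo (J k) t
    c = hi (J k) - t

  -- This set need not be down-closed: a gap followed by overlapping intervals can make a later
  -- point filled again. Hence `supFilled` takes everything below some filled point.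
  Filled : Pred ℚ 0ℓ
  Filled t = ∃[ n ] t ≤ partialLengthUpTo J t n

  Filled-extend : ∀ k {t} → lo (J k) ≤ t → t ≤ hi (J k) → t ∈ Filled → hi (J k) ∈ Filled
  -- This many summands include the first `n` as well as that of `J k`.
  Filled-extend k {t} lo≤t t≤hi (n , t≤) = suc k ℕ.+ n , (begin
    hi (J k)                                             ≡⟨ cancel t (hi (J k)) ⟨
    t + (hi (J k) - t)                                   ≤⟨ +-monoˡ-≤ _ (≤-trans t≤ (partialLengthUpTo-≤+ t n (suc k))) ⟩
    partialLengthUpTo J t (suc k ℕ.+ n) + (hi (J k) - t) ≤⟨ partialLengthUpTo-grow (ℕ.m≤m+n (suc k) n) lo≤t t≤hi ⟩
    partialLengthUpTo J (hi (J k)) (suc k ℕ.+ n)         ∎)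
    where open ≤-Reasoning

  -- A point of J k close below this supremum is filled, hence so is hi (J k).
  supFilled : ∀ c → (∀ n → partialLength J n ≤ c) → ℝ
  supFilled c bound = record
    { cut = record
      { below   = λ q → ∃[ t ] (q < t) × t ∈ Filled
      ; down    = λ p<q (t , q<t , t∈) → t , <-trans p<q q<t , t∈
      ; rounded = λ (t , p<t , t∈) → let m , p<m , m<t = <-dense p<t in m , p<m , t , m<t , t∈
      }
    ; inhabited = - 1ℚ , 0ℚ , negative⁻¹ (- 1ℚ) , 0 , ≤-refl
    ; bounded   = c , λ (t , c<t , n , t≤) →
        <-irrefl refl (<-≤-trans c<t (≤-trans t≤ (≤-trans (partialLengthUpTo≤partialLength n t) (bound n))))
    }

  -- Completeness of ℝ, through `supFilled`, replaces the extraction of a finite subcover.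
  cover-unbounded : (∀ x → ∃[ k ] x ∈ ⟦ J k ⟧) → ∀ c → ¬ (∀ n → partialLength J n ≤ c)
  cover-unbounded cover c bound =
    let k , (t , lo<t , t∈) , (p , p<hi , p∉) = cover (supFilled c bound)
        -- No filled point exceeds `p`. So `t` lies in `J k`, while filling `hi (J k)`, which is
        -- above `p`, is absurd.
        t≤p = ≮⇒≥ (λ p<t → p∉ (t , p<t , t∈))
    in p∉ (hi (J k) , p<hi , Filled-extend k (<⇒≤ lo<t) (≤-trans t≤p (<⇒≤ p<hi)) t∈)

-- Adding an interval to a sequence of bounded total length.

infixr 5 _◂_

_◂_ : Interval → (ℕ → Interval) → ℕ → Interval
(I ◂ J) zero    = I
(I ◂ J) (suc n) = J n

partialLength-◂ : ∀ I J n → partialLength (I ◂ J) (suc n) ≡ (hi I - lo I) + partialLength J n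
partialLength-◂ I J zero    = trans (+-identityˡ (hi I - lo I)) (sym (+-identityʳ (hi I - lo I)))
partialLength-◂ I J (suc n) = trans (cong (_+ (hi (J n) - lo (J n))) (partialLength-◂ I J n))
  (+-assoc (hi I - lo I) (partialLength J n) (hi (J n) - lo (J n)))

partialLength-◂≤ : ∀ I J {c} → (∀ n → partialLength J n ≤ c) →
                   ∀ n → partialLength (I ◂ J) n ≤ (hi I - lo I) + c
partialLength-◂≤ I J bound zero    =
  -- Here `bound 0` says that `c` is nonnegative.
  ≤-trans (≤-reflexive (sym (+-identityʳ 0ℚ))) (+-mono-≤ 0≤length (bound 0))
  where
  0≤length : 0ℚ ≤ hi I - lo I
  0≤length = subst (_≤ hi I - lo I) (+-inverseʳ (lo I)) (+-monoˡ-≤ (- lo I) (lo≤hi I))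
partialLength-◂≤ I J bound (suc n) =
  ≤-trans (≤-reflexive (partialLength-◂ I J n)) (+-monoʳ-≤ (hi I - lo I) (bound n))

-- Pads finite covers, since a `Cover` is an infinite sequence.
emptyInterval : Interval
emptyInterval = record { lo = 0ℚ ; hi = 0ℚ ; lo≤hi = ≤-refl }

partialLength-empty : ∀ n → partialLength (λ _ → emptyInterval) n ≡ 0ℚ
partialLength-empty zero    = refl
partialLength-empty (suc n) = cong (_+ (0ℚ - 0ℚ)) (partialLength-empty n)

interval-open : Interval → Open ℝ-space
interval-open I = record { set = ⟦ I ⟧ ; isOpen = λ x x∈I → lo I , hi I , x∈I , λ _ y∈I → y∈I }

-- Order on the extended half-line and on set functions.

rational : ∀ q → 0ℚ ≤ q → ℝ₊
rational q 0≤q = record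
  { cut = record
    { below   = λ p → Lift 1ℓ (p < q)
    ; down    = λ p<p′ (lift p′<q) → lift (<-trans p<p′ p′<q)
    ; rounded = λ (lift p<q) → let m , p<m , m<q = <-dense p<q in m , p<m , lift m<q
    }
  ; nonneg = λ p<0 → lift (<-≤-trans p<0 0≤q)
  } , q , λ (lift q<q) → <-irrefl refl q<q

+∞-mono : ∀ {x x′ y y′} → x ≤∞ x′ → y ≤∞ y′ → x +∞ y ≤∞ x′ +∞ y′
+∞-mono x≤x′ y≤y′ (s , t , s∈ , t∈ , q<) = s , t , x≤x′ s∈ , y≤y′ t∈ , q<

*∞-monoʳ : ∀ x {y y′} → y ≤∞ y′ → x *∞ y ≤∞ x *∞ y′
*∞-monoʳ x y≤y′ (inj₁ q<0)                             = inj₁ q<0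
*∞-monoʳ x y≤y′ (inj₂ (s , t , s∈ , t∈ , 0<s , 0<t , q<)) = inj₂ (s , t , s∈ , y≤y′ t∈ , 0<s , 0<t , q<)

<∞-≤∞-trans : ∀ x y z → x <∞ y → y ≤∞ z → x <∞ z
<∞-≤∞-trans x y z (q , q∉x , q∈y) y≤z = q , q∉x , y≤z q∈y

module _ {X : TopologicalSpace} where
  open TopologicalSpace X

  -- A Dirac valuation sees an open set only through membership of `x`, so `V` can be compared with
  -- a `W` about which only some points are known.
  δ-mono : ∀ x {V W : Open X} → (x ∈ set V → x ∈ set W) → δ {X} x V ≤∞ δ {X} x W
  δ-mono x V⇒W (lift (inj₁ q<0))         = lift (inj₁ q<0)
  δ-mono x V⇒W (lift (inj₂ (x∈V , q<1))) = lift (inj₂ (V⇒W x∈V , q<1))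

  PointContinuous-resp-≋ : ∀ (μ ν : SetFunction X) → μ ≋ ν → PointContinuous {X} μ → PointContinuous {X} ν
  PointContinuous-resp-≋ μ ν μ≋ν pc V r r<νV =
    let A , A⊆V , r< = pc V r (<∞-≤∞-trans (proj₁ r) (ν V) (μ V) r<νV (proj₂ (μ≋ν V)))
    in A , A⊆V , λ W A⊆W → <∞-≤∞-trans (proj₁ r) (μ W) (ν W) (r< W A⊆W) (proj₁ (μ≋ν W))

-- Pointwise directed suprema and point-continuity of minimal valuations.

module Classical (em : ∀ {ℓ} → ExcludedMiddle ℓ) where

  -- A supremum indexed by Set₂ asks for cuts in Set₂, whereas those of [0,∞]
  -- live in Set₁: excluded middle brings them down.

  Resize : ∀ {ℓ} → Set ℓ → Set 1ℓ
  Resize P = Lift 1ℓ (True (em {P = P}))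

  resize : ∀ {ℓ} {P : Set ℓ} → P → Resize P
  resize p = lift (fromWitness p)

  unresize : ∀ {ℓ} {P : Set ℓ} → Resize P → P
  unresize (lift p) = toWitness p

  ⨆ : {I : Set₂} → I → (I → [0,∞]) → [0,∞]
  ⨆ i₀ g = record
    { cut = record
      { below   = λ q → Resize (∃[ i ] q ∈ [0,∞].below (g i))
      ; down    = λ p<q q∈ → let i , q∈i = unresize q∈ in resize (i , [0,∞].down (g i) p<q q∈i)
      ; rounded = λ p∈ → let i , p∈i = unresize p∈
                             q , p<q , q∈i = [0,∞].rounded (g i) p∈i
                         in q , p<q , resize (i , q∈i)
      }
    ; nonneg = λ q<0 → resize (i₀ , [0,∞].nonneg (g i₀) q<0)
    }

  module _ {X : TopologicalSpace} where
    open TopologicalSpace X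

    module _ {I : Set₂} (f : I → ContinuousValuation X) (dir : Directed _≼_ f) where
      private
        i₀  = proj₁ dir
        sup : SetFunction X
        sup V = ⨆ i₀ (λ i → apply (f i) V)

        -- The two summands may be witnessed at different indices; directedness moves both to one
        -- `f l`, whose own modularity then applies.
        sup-modular : ∀ V W → sup (V ⊔ᵒ W) +∞ sup (V ⊓ W) ≈∞ sup V +∞ sup W
        sup-modular V W = to , from
          where
          to : sup (V ⊔ᵒ W) +∞ sup (V ⊓ W) ≤∞ sup V +∞ sup W
          to (s , t , s∈ , t∈ , q<) =
            let j , s∈j = unresize s∈
                k , t∈k = unresize t∈
                l , j≼l , k≼l = proj₂ dir j k
                s′ , t′ , s′∈ , t′∈ , q<′ = proj₁ (modular (isValuation (f l)) V W)
                  (s , t , j≼l (V ⊔ᵒ W) s∈j , k≼l (V ⊓ W) t∈k , q<)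
            in s′ , t′ , resize (l , s′∈) , resize (l , t′∈) , q<′

          from : sup V +∞ sup W ≤∞ sup (V ⊔ᵒ W) +∞ sup (V ⊓ W)
          from (s , t , s∈ , t∈ , q<) =
            let j , s∈j = unresize s∈
                k , t∈k = unresize t∈
                l , j≼l , k≼l = proj₂ dir j k
                s′ , t′ , s′∈ , t′∈ , q<′ = proj₂ (modular (isValuation (f l)) V W)
                  (s , t , j≼l V s∈j , k≼l W t∈k , q<)
            in s′ , t′ , resize (l , s′∈) , resize (l , t′∈) , q<′

        sup-monotonic : ∀ {V W} → V ⊑ W → sup V ≤∞ sup W
        sup-monotonic V⊑W q∈ = let i , q∈i = unresize q∈ in resize (i , monotonic (isValuation (f i)) V⊑W q∈i)

      -- A supremum for `_≼_` is least only among continuous valuations. Once the pointwise supremum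
      -- is known to be one, it can be compared with that supremum.
      pointwiseSup : ContinuousValuation X
      pointwiseSup = record
        { apply           = sup
        ; isValuation     = record
          { strict    = (λ q∈ → let i , q∈i = unresize q∈ in proj₁ (strict (isValuation (f i))) q∈i)
                      , (λ q<0 → resize (i₀ , proj₂ (strict (isValuation (f i₀))) q<0))
          ; modular   = sup-modular
          ; monotonic = sup-monotonic
          }
        ; scottContinuous = λ g g-dir W W-sup →
            (λ j → sup-monotonic (proj₁ W-sup j)) ,
            -- Suprema commute: a bound of all `sup (g j)` bounds `apply (f i) (g j)` for each fixed
            -- `i`, where Scott-continuity of `f i` applies.
            (λ t ub q∈ →
              let i , q∈i = unresize q∈
              in proj₂ (scottContinuous (f i) g g-dir W W-sup) t (λ j p∈ → ub j (resize (i , p∈))) q∈i)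
        }

      pointwiseSup-upper : ∀ i → f i ≼ pointwiseSup
      pointwiseSup-upper i V q∈ = resize (i , q∈)

    -- `A` collects the points of `ts` lying in `V`. The other terms vanish on `V`, so `simple ts V`
    -- is at most the value at any neighbourhood of `A`, whatever `r` is.
    simple-pointContinuous : ∀ ts → PointContinuous {X} (simple ts)
    simple-pointContinuous ts V r r< =
      let A , A⊆V , ≤W = support ts in A , A⊆V , λ W A⊆W → <∞-≤∞-trans (proj₁ r) (simple ts V) (simple ts W) r< (≤W W A⊆W)
      where
      support : ∀ ts → ∃[ A ] All (_∈ set V) A ×
                (∀ (W : Open X) → All (_∈ set W) A → simple {X} ts V ≤∞ simple {X} ts W)
      support [] = [] , [] , λ _ _ → id
      support (((r , _) , x) ∷ ts) with support ts | em {P = x ∈ set V}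
      ... | A , A⊆V , ≤W | yes x∈V = x ∷ A , x∈V ∷ A⊆V , λ { W (x∈W ∷ A⊆W) →
        +∞-mono {r *∞ δ {X} x V} {r *∞ δ {X} x W} {simple {X} ts V} {simple {X} ts W}
          (*∞-monoʳ r {δ {X} x V} {δ {X} x W} (δ-mono x {V} {W} (λ _ → x∈W))) (≤W W A⊆W) }
      ... | A , A⊆V , ≤W | no x∉V = A , A⊆V , λ W A⊆W →
        +∞-mono {r *∞ δ {X} x V} {r *∞ δ {X} x W} {simple {X} ts V} {simple {X} ts W}
          (*∞-monoʳ r {δ {X} x V} {δ {X} x W} (δ-mono x {V} {W} (λ x∈V → contradiction x∈V x∉V))) (≤W W A⊆W)

    minimal⇒pointContinuous : ∀ {ν} → Minimal {X} ν → PointContinuous (apply ν)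
    minimal⇒pointContinuous {ν} (isSimple ts ν≋) =
      PointContinuous-resp-≋ (simple ts) (apply ν) (λ V → proj₂ (ν≋ V) , proj₁ (ν≋ V)) (simple-pointContinuous ts)
    minimal⇒pointContinuous {ν} (directedSup f dir min (f≼ν , least)) V r (q , q∉r , q∈νV) =
      -- The rational `q` separating `r` from `ν V` is already below some `f i` at `V`, and the
      -- finite set obtained for `f i` serves for `ν`.
      let i , q∈fiV = unresize (least (pointwiseSup f dir) (pointwiseSup-upper f dir) V q∈νV)
          A , A⊆V , r< = minimal⇒pointContinuous (min i) V r (q , q∉r , q∈fiV)
      in A , A⊆V , λ W A⊆W → <∞-≤∞-trans (proj₁ r) (apply (f i) W) (apply ν W) (r< W A⊆W) (f≼ν i W)

  -- Small neighbourhoods of finite sets and the Lebesgue valuation.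

  cover-exceeds : (J : ℕ → Interval) → (∀ x → ∃[ k ] x ∈ ⟦ J k ⟧) → ∀ c → ∃[ n ] c < partialLength J n
  cover-exceeds J cover c = decidable-stable em λ none →
    cover-unbounded J cover c (λ n → ≮⇒≥ (λ c< → none (n , c<)))

  -- Walks along `a`, `a + ε`, and so on until the next point is no longer below `x`; `n` bounds the
  -- number of steps, and exhausting them contradicts `a <ℝ x`.
  step-across : ∀ (x : ℝ) {a ε} → a <ℝ x → ∀ n → ¬ ((a + n · ε) <ℝ x) →
                ∃[ b ] (b <ℝ x) × ¬ ((b + ε) <ℝ x)
  step-across x {a} a<x zero a≮x = contradiction (subst (_<ℝ x) (sym (+-identityʳ a)) a<x) a≮x
  step-across x {a} {ε} a<x (suc n) a+≮x with em {P = (a + ε) <ℝ x}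
  ... | no  a+ε≮x = a , a<x , a+ε≮x
  ... | yes a+ε<x = step-across x a+ε<x n (subst (λ p → ¬ (p <ℝ x)) (sym (+-assoc a ε (n · ε))) a+≮x)

  shortInterval : ∀ (x : ℝ) {ε} → 0ℚ < ε → ∃[ I ] x ∈ ⟦ I ⟧ × (hi I - lo I ≡ ε)
  shortInterval x {ε} 0<ε =
    -- Steps shorter than `ε` leave the strict gap between `c + η` and `c + ε` that `x ℝ< c + ε`
    -- demands.
    let η , 0<η , η<ε = <-dense 0<ε
        a , a<x = ℝ.inhabited x
        b , b≮x = ℝ.bounded x
        n , b-a≤ = archimedean (b - a) 0<η
        b≤ = subst (_≤ a + n · η) (cancel a b) (+-monoʳ-≤ a b-a≤)
        c , c<x , c+η≮x = step-across x a<x n (λ <x → b≮x (down-≤ b≤ <x))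
    in record { lo = c ; hi = c + ε ; lo≤hi = <⇒≤ (p<p+q c 0<ε) }
     , (c<x , c + η , +-monoʳ-< c η<ε , c+η≮x)
     , solve 2 (λ c e → (c :+ e) :- c := e) refl c ε
    where
    open +-*-Solver
    down-≤ : ∀ {p q} → p ≤ q → q <ℝ x → p <ℝ x
    down-≤ p≤q q<x = let m , q<m , m<x = ℝ.rounded x q<x in ℝ.down x (≤-<-trans p≤q q<m) m<x

  smallNeighbourhood : ∀ A {ε} → 0ℚ < ε → ∃[ W ] All (_∈ set {ℝ-space} W) A ×
    (Σ[ C ∈ Cover (set W) ] ∀ n → partialLength (proj₁ C) n ≤ ε)
  smallNeighbourhood [] 0<ε = ∅ , [] , ((λ _ → emptyInterval) , λ ()) ,
    λ n → ≤-trans (≤-reflexive (partialLength-empty n)) (<⇒≤ 0<ε)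
  smallNeighbourhood (x ∷ A) {ε} 0<ε =
    -- The length `ε` is shared out: `ε - η` for `x` and `η` for the rest of the list.
    let η , 0<η , η<ε = <-dense 0<ε
        I , x∈I , lengthI = shortInterval x (p<q⇒0<q-p η<ε)
        W , A⊆W , (J , W⊆J) , bound = smallNeighbourhood A 0<η
    in interval-open I ⊔ᵒ W
     , inj₁ x∈I ∷ All.map inj₂ A⊆W
     , (I ◂ J , λ { (inj₁ y∈I) → 0 , y∈I ; (inj₂ y∈W) → let n , y∈ = W⊆J y∈W in suc n , y∈ })
     , λ n → ≤-trans (partialLength-◂≤ I J bound n)
         (≤-reflexive (trans (+-comm _ η) (trans (cong (_+_ η) lengthI) (cancel η ε))))

  ¬lebesgue-pointContinuous : ¬ PointContinuous lebesgueValuation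
  ¬lebesgue-pointContinuous pc =
    -- Point-continuity is tested on the whole line with `r = 1`; the resulting `A` has a
    -- neighbourhood of measure at most 1.
    let A , _ , 1<λ = pc ℝ-full (rational 1ℚ 0≤1) (1ℚ , (λ (lift 1<1) → <-irrefl refl 1<1) , 1∈λℝ)
        W , A⊆W , C , bound = smallNeighbourhood A (positive⁻¹ 1ℚ)
        q , q≮1 , q′ , q<q′ , q′< = 1<λ W A⊆W
        lift (n , q′<n) = q′< C
    in q≮1 (lift (<-≤-trans (<-trans q<q′ q′<n) (bound n)))
    where
    0≤1 : 0ℚ ≤ 1ℚ
    0≤1 = nonNegative⁻¹ 1ℚ
    ℝ-full : Open ℝ-space
    ℝ-full = record { isOpen = TopologicalSpace.Full-open ℝ-space }
    1∈λℝ : 1ℚ ∈ [0,∞].below (lebesgueValuation ℝ-full)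
    -- Being below the infimum requires a lower bound strictly above 1; 2 is one, as every cover has
    -- infinite total length.
    1∈λℝ = 1ℚ + 1ℚ , p<p+q 1ℚ (positive⁻¹ 1ℚ) ,
      λ (J , cover) → lift (cover-exceeds J (λ x → cover {x} tt) (1ℚ + 1ℚ))

lemma6p1 : (∀ {ℓ} → ExcludedMiddle ℓ) →
    ¬ PointContinuous lebesgueValuation × ¬ IsMinimal lebesgueValuation
lemma6p1 em = ¬lebesgue-pointContinuous , λ (ν , min , ν≋λ) →
  ¬lebesgue-pointContinuous (PointContinuous-resp-≋ (apply ν) lebesgueValuation ν≋λ (minimal⇒pointContinuous min))
  where open Classical em
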